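{- Let $p$ be an odd prime such that $(p,p)$ is hyperbolic, i.e. $1/p+1/p<1/2$. Then the regular map of type $(p,p)$ given by the generating triple $(X,Y,Z)$ of matrices described in the context is not self-Petrie-dual.
   Context: A regular map of type $(k,l)$ (vertex degree $k$, face length $l$) is identified with a group $G$ generated by three involutions $X,Y,Z$ such that $XY$, $YZ$, $ZX$ have orders exactly $2,k,l$ respectively. The map is self-Petrie-dual if $G$ has an (involutory) automorphism fixing $Y$ and $Z$ and interchanging $X$ and $XY$. The maps considered have $G$ isomorphic to $PSL(2,q)$ or $PGL(2,q)$ with $q$ a power of the odd prime $p$. Matrices are regarded up to nonzero scalar multiples, i.e. as elements of $PGL(2,K)$ with $K$ an algebraic closure of $GF(p)$. For type $(p,p)$ the generating triple is, with $\alpha^2=-1$, $$X=-\alpha\begin{pmatrix}1&0\\2&-1\end{pmatrix},\quad Y=-\alpha\begin{pmatrix}1&-1\\0&-1\end{pmatrix},\quad Z=\alpha\begin{pmatrix}1&0\\0&-1\end{pmatrix}.$$ -}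

module Defs where

open import Level using (Level; _⊔_) renaming (suc to lsuc)
open import Algebra.Bundles using (Group; CommutativeRing; CommutativeMonoid)
open import Algebra.Apartness.Bundles using (HeytingField; HeytingCommutativeRing)
import Algebra.Properties.CommutativeSemigroup as CommutativeSemigroupProperties
open import Algebra.Morphism.Structures using (module GroupMorphisms)
import Algebra.Apartness.Properties.HeytingCommutativeRing as HeytingProperties
import Algebra.Definitions.RawMonoid as RawMonoidDefinitions
import Algebra.Properties.Semiring.Mult as SemiringMult
import Algebra.Properties.Ring as RingProperties
open import Data.Nat.Base as ℕ using (ℕ; suc; NonZero; _<_; s≤s; z≤n)
import Data.Nat.Properties as ℕ
open import Data.Nat.Divisibility using (_∣_; ∣⇒≤; ∣-refl; m%n≡0⇒n∣m)
open import Data.Nat.DivMod using (_/_; _%_; m≡m%n+[m/n]*n; m%n<n)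
open import Data.Nat.Primality using (Prime; prime⇒nonZero)
open import Data.Integer.Base using (+_)
import Data.Rational.Base as ℚ
open import Data.Product.Base using (Σ; ∃; ∃₂; _×_; _,_; proj₁; proj₂)
open import Data.Vec.Base using (Vec; []; _∷_; map)
open import Function.Bundles using (_⇔_; module Equivalence)
open import Relation.Binary.PropositionalEquality as ≡ using (_≡_)
import Relation.Binary.Reasoning.Setoid as SetoidReasoning
open import Relation.Nullary using (¬_; contradiction)

------------------------------------------------------------------------
-- Groups

module _ {c ℓ} (G : Group c ℓ) where

  open Group G

  -- The library's monoid multiple, read multiplicatively.
  infixl 8 _^_
  _^_ : Carrier → ℕ → Carrier
  g ^ n = RawMonoidDefinitions._×_ rawMonoid n g

  record HasOrder (g : Carrier) (n : ℕ) : Set ℓ where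
    field
      positive : 0 < n
      power    : g ^ n ≈ ε
      minimal  : ∀ m → 0 < m → m < n → ¬ (g ^ m ≈ ε)

  data Generated (X Y Z : Carrier) : Carrier → Set (c ⊔ ℓ) where
    genX : Generated X Y Z X
    genY : Generated X Y Z Y
    genZ : Generated X Y Z Z
    unit : Generated X Y Z ε
    mul  : ∀ {g h} → Generated X Y Z g → Generated X Y Z h →
           Generated X Y Z (g ∙ h)
    inv  : ∀ {g} → Generated X Y Z g → Generated X Y Z (g ⁻¹)
    resp : ∀ {g h} → g ≈ h → Generated X Y Z g → Generated X Y Z h

  subgroupGeneratedBy : (X Y Z : Carrier) → Group (c ⊔ ℓ) ℓ
  subgroupGeneratedBy X Y Z = record
    { Carrier = Σ Carrier (Generated X Y Z)
    ; _≈_     = λ g h → proj₁ g ≈ proj₁ h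
    ; _∙_     = λ (g , p) (h , q) → g ∙ h , mul p q
    ; ε       = ε , unit
    ; _⁻¹     = λ (g , p) → g ⁻¹ , inv p
    ; isGroup = record
      { isMonoid = record
        { isSemigroup = record
          { isMagma = record
            { isEquivalence = record { refl = refl ; sym = sym ; trans = trans }
            ; ∙-cong = ∙-cong
            }
          ; assoc = λ g h k → assoc (proj₁ g) (proj₁ h) (proj₁ k)
          }
        ; identity = (λ g → identityˡ (proj₁ g)) , (λ g → identityʳ (proj₁ g))
        }
      ; inverse = (λ g → inverseˡ (proj₁ g)) , (λ g → inverseʳ (proj₁ g))
      ; ⁻¹-cong = ⁻¹-cong
      }
    }

------------------------------------------------------------------------
-- Regular maps

-- A regular map of type (k , l), i.e. of vertex degree k and face length l,
-- is identified with its group and generating triple.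
record RegularMap (k l : ℕ) (c ℓ : Level) : Set (lsuc (c ⊔ ℓ)) where
  field
    group : Group c ℓ
  open Group group public
  field
    X Y Z      : Carrier
    generating : ∀ g → Generated group X Y Z g
    orderX     : HasOrder group X 2
    orderY     : HasOrder group Y 2
    orderZ     : HasOrder group Z 2
    orderXY    : HasOrder group (X ∙ Y) 2
    orderYZ    : HasOrder group (Y ∙ Z) k
    orderZX    : HasOrder group (Z ∙ X) l

-- The automorphism is automatically involutory, since its square fixes the
-- generators X, Y and Z.
record SelfPetrieDual {k l c ℓ} (M : RegularMap k l c ℓ) : Set (c ⊔ ℓ) where
  open RegularMap M
  open GroupMorphisms rawGroup rawGroup using (IsGroupIsomorphism)
  field
    φ              : Carrier → Carrier
    isAutomorphism : IsGroupIsomorphism φ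
    φY≈Y           : φ Y ≈ Y
    φZ≈Z           : φ Z ≈ Z
    φX≈XY          : φ X ≈ X ∙ Y
    φXY≈X          : φ (X ∙ Y) ≈ X

Hyperbolic : (k l : ℕ) .{{_ : NonZero k}} .{{_ : NonZero l}} → Set
Hyperbolic k l = (+ 1 ℚ./ k) ℚ.+ (+ 1 ℚ./ l) ℚ.< (+ 1 ℚ./ 2)

------------------------------------------------------------------------
-- Algebraic closures of GF(p)

module _ {c ℓ₁ ℓ₂} (K : HeytingField c ℓ₁ ℓ₂) where

  open HeytingField K

  fromℕ : ℕ → Carrier
  fromℕ n = RawMonoidDefinitions._×_ +-rawMonoid n 1#
    where open HeytingCommutativeRing heytingCommutativeRing using (commutativeRing)
          open CommutativeRing commutativeRing using (+-rawMonoid)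

  -- The value at x of the monic polynomial tⁿ + aₙ₋₁tⁿ⁻¹ + … + a₁t + a₀
  -- with (non-leading) coefficients a₀ ∷ a₁ ∷ … ∷ aₙ₋₁ ∷ [].
  evalMonic : ∀ {n} → Vec Carrier n → Carrier → Carrier
  evalMonic []       x = 1#
  evalMonic (a ∷ as) x = a + x * evalMonic as x

  -- For p prime the characteristic condition says that the prime field
  -- { fromℕ n } of K is a copy of GF(p).
  record IsAlgebraicClosureOfGF (p : ℕ) : Set (c ⊔ ℓ₁) where
    field
      characteristic      : ∀ n → (fromℕ n ≈ 0#) ⇔ (p ∣ n)
      algebraicallyClosed : ∀ n (as : Vec Carrier (suc n)) →
                            ∃ λ x → evalMonic as x ≈ 0#
      algebraic           : ∀ x → ∃₂ λ n (as : Vec ℕ (suc n)) →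
                            evalMonic (map fromℕ as) x ≈ 0#

  SquareRootOfMinusOne : Carrier → Set ℓ₁
  SquareRootOfMinusOne α = α * α ≈ - 1#

------------------------------------------------------------------------
-- PGL(2,K)

module PGL₂ {c ℓ₁ ℓ₂} (K : HeytingField c ℓ₁ ℓ₂) where

  open HeytingField K
  open HeytingCommutativeRing heytingCommutativeRing using (commutativeRing)
  open CommutativeRing commutativeRing
    using (+-commutativeMonoid; *-commutativeSemigroup)
  open HeytingProperties heytingCommutativeRing
    using (1#0; x-0≈x; x#0y#0→xy#0; invertibleʳ⇒#)
  open CommutativeSemigroupProperties *-commutativeSemigroup
    using (interchange)
  open CommutativeSemigroupProperties (CommutativeMonoid.commutativeSemigroup +-commutativeMonoid)
    using () renaming (interchange to +-interchange)
  open SetoidReasoning setoid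

  record Matrix : Set c where
    constructor mat
    field
      m₁₁ m₁₂
        m₂₁ m₂₂ : Carrier

  open Matrix public

  infix 4 _≋_ _∼_
  infixl 7 _⊗_
  infixr 8 _•_

  record _≋_ (A B : Matrix) : Set ℓ₁ where
    constructor mk≋
    field
      e₁₁ : m₁₁ A ≈ m₁₁ B
      e₁₂ : m₁₂ A ≈ m₁₂ B
      e₂₁ : m₂₁ A ≈ m₂₁ B
      e₂₂ : m₂₂ A ≈ m₂₂ B

  open _≋_ public

  _⊗_ : Matrix → Matrix → Matrix
  A ⊗ B = mat (m₁₁ A * m₁₁ B + m₁₂ A * m₂₁ B) (m₁₁ A * m₁₂ B + m₁₂ A * m₂₂ B)
              (m₂₁ A * m₁₁ B + m₂₂ A * m₂₁ B) (m₂₁ A * m₁₂ B + m₂₂ A * m₂₂ B)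

  I : Matrix
  I = mat 1# 0#
          0# 1#

  _•_ : Carrier → Matrix → Matrix
  s • A = mat (s * m₁₁ A) (s * m₁₂ A)
              (s * m₂₁ A) (s * m₂₂ A)

  _∼_ : Matrix → Matrix → Set (c ⊔ ℓ₁ ⊔ ℓ₂)
  A ∼ B = ∃ λ s → (s # 0#) × (A ≋ s • B)

  record GL₂ : Set (c ⊔ ℓ₁) where
    field
      matrix   : Matrix
      inverse  : Matrix
      inverseˡ : inverse ⊗ matrix ≋ I
      inverseʳ : matrix ⊗ inverse ≋ I

  open GL₂ public using (matrix)

  ≋-refl : ∀ {A} → A ≋ A
  ≋-refl = mk≋ refl refl refl refl

  ≋-sym : ∀ {A B} → A ≋ B → B ≋ A
  ≋-sym (mk≋ a b c d) = mk≋ (sym a) (sym b) (sym c) (sym d)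

  ≋-trans : ∀ {A B C} → A ≋ B → B ≋ C → A ≋ C
  ≋-trans (mk≋ a b c d) (mk≋ a′ b′ c′ d′) =
    mk≋ (trans a a′) (trans b b′) (trans c c′) (trans d d′)

  ⊗-cong : ∀ {A B C D} → A ≋ B → C ≋ D → A ⊗ C ≋ B ⊗ D
  ⊗-cong (mk≋ a b c d) (mk≋ a′ b′ c′ d′) = mk≋
    (+-cong (*-cong a a′) (*-cong b c′)) (+-cong (*-cong a b′) (*-cong b d′))
    (+-cong (*-cong c a′) (*-cong d c′)) (+-cong (*-cong c b′) (*-cong d d′))

  •-congˡ : ∀ {s A B} → A ≋ B → s • A ≋ s • B
  •-congˡ (mk≋ a b c d) = mk≋ (*-congˡ a) (*-congˡ b) (*-congˡ c) (*-congˡ d)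

  •-congʳ : ∀ {s t A} → s ≈ t → s • A ≋ t • A
  •-congʳ e = mk≋ (*-congʳ e) (*-congʳ e) (*-congʳ e) (*-congʳ e)

  •-assoc : ∀ s t A → s • t • A ≋ (s * t) • A
  •-assoc s t A = ≋-sym (mk≋ (*-assoc s t _) (*-assoc s t _) (*-assoc s t _) (*-assoc s t _))

  1•A≋A : ∀ A → 1# • A ≋ A
  1•A≋A A = mk≋ (*-identityˡ _) (*-identityˡ _) (*-identityˡ _) (*-identityˡ _)

  •-⊗ : ∀ s t A B → (s • A) ⊗ (t • B) ≋ (s * t) • (A ⊗ B)
  •-⊗ s t A B = mk≋ (entry _ _ _ _) (entry _ _ _ _) (entry _ _ _ _) (entry _ _ _ _)
    where
    entry : ∀ w x y z → (s * w) * (t * x) + (s * y) * (t * z) ≈ (s * t) * (w * x + y * z)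
    entry w x y z = begin
      (s * w) * (t * x) + (s * y) * (t * z) ≈⟨ +-cong (interchange s w t x) (interchange s y t z) ⟩
      (s * t) * (w * x) + (s * t) * (y * z) ≈⟨ distribˡ _ _ _ ⟨
      (s * t) * (w * x + y * z)             ∎

  ⊗-assoc : ∀ A B C → (A ⊗ B) ⊗ C ≋ A ⊗ (B ⊗ C)
  ⊗-assoc A B C = mk≋ (entry _ _ _ _ _ _ _ _) (entry _ _ _ _ _ _ _ _)
                      (entry _ _ _ _ _ _ _ _) (entry _ _ _ _ _ _ _ _)
    where
    entry : ∀ a₁ a₂ b₁₁ b₁₂ b₂₁ b₂₂ c₁ c₂ →
            (a₁ * b₁₁ + a₂ * b₂₁) * c₁ + (a₁ * b₁₂ + a₂ * b₂₂) * c₂ ≈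
            a₁ * (b₁₁ * c₁ + b₁₂ * c₂) + a₂ * (b₂₁ * c₁ + b₂₂ * c₂)
    entry a₁ a₂ b₁₁ b₁₂ b₂₁ b₂₂ c₁ c₂ = begin
      (a₁ * b₁₁ + a₂ * b₂₁) * c₁ + (a₁ * b₁₂ + a₂ * b₂₂) * c₂
        ≈⟨ +-cong (distribʳ _ _ _) (distribʳ _ _ _) ⟩
      (a₁ * b₁₁ * c₁ + a₂ * b₂₁ * c₁) + (a₁ * b₁₂ * c₂ + a₂ * b₂₂ * c₂)
        ≈⟨ +-interchange _ _ _ _ ⟩
      (a₁ * b₁₁ * c₁ + a₁ * b₁₂ * c₂) + (a₂ * b₂₁ * c₁ + a₂ * b₂₂ * c₂)
        ≈⟨ +-cong (+-cong (*-assoc _ _ _) (*-assoc _ _ _)) (+-cong (*-assoc _ _ _) (*-assoc _ _ _)) ⟩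
      (a₁ * (b₁₁ * c₁) + a₁ * (b₁₂ * c₂)) + (a₂ * (b₂₁ * c₁) + a₂ * (b₂₂ * c₂))
        ≈⟨ +-cong (distribˡ _ _ _) (distribˡ _ _ _) ⟨
      a₁ * (b₁₁ * c₁ + b₁₂ * c₂) + a₂ * (b₂₁ * c₁ + b₂₂ * c₂) ∎

  1x+0y : ∀ {x y} → 1# * x + 0# * y ≈ x
  1x+0y = trans (+-cong (*-identityˡ _) (zeroˡ _)) (+-identityʳ _)

  0x+1y : ∀ {x y} → 0# * x + 1# * y ≈ y
  0x+1y = trans (+-cong (zeroˡ _) (*-identityˡ _)) (+-identityˡ _)

  x1+y0 : ∀ {x y} → x * 1# + y * 0# ≈ x
  x1+y0 = trans (+-cong (*-identityʳ _) (zeroʳ _)) (+-identityʳ _)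

  x0+y1 : ∀ {x y} → x * 0# + y * 1# ≈ y
  x0+y1 = trans (+-cong (zeroʳ _) (*-identityʳ _)) (+-identityˡ _)

  ⊗-identityˡ : ∀ A → I ⊗ A ≋ A
  ⊗-identityˡ A = mk≋ 1x+0y 1x+0y 0x+1y 0x+1y

  ⊗-identityʳ : ∀ A → A ⊗ I ≋ A
  ⊗-identityʳ A = mk≋ x1+y0 x0+y1 x1+y0 x0+y1

  ≋⇒∼ : ∀ {A B} → A ≋ B → A ∼ B
  ≋⇒∼ {B = B} A≋B = 1# , 1#0 , ≋-trans A≋B (≋-sym (1•A≋A B))

  •∼ : ∀ {s A} → s # 0# → s • A ∼ A
  •∼ s#0 = _ , s#0 , ≋-refl

  x#0⇒inverse : ∀ {x} → x # 0# → ∃ λ y → (y # 0#) × (y * x ≈ 1#)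
  x#0⇒inverse {x} x#0 with #⇒invertible x#0
  ... | y , yx≈1 , _ = y , invertibleʳ⇒# (x , trans (*-congʳ (x-0≈x y)) yx≈1′) , yx≈1′
    where
    yx≈1′ : y * x ≈ 1#
    yx≈1′ = trans (*-congˡ (sym (x-0≈x x))) yx≈1

  ∼-refl : ∀ {A} → A ∼ A
  ∼-refl = ≋⇒∼ ≋-refl

  ∼-sym : ∀ {A B} → A ∼ B → B ∼ A
  ∼-sym {A} {B} (s , s#0 , A≋sB) with x#0⇒inverse s#0
  ... | t , t#0 , ts≈1 = t , t#0 ,
    ≋-sym (≋-trans (•-congˡ A≋sB)
          (≋-trans (•-assoc t s B)
          (≋-trans (•-congʳ ts≈1) (1•A≋A B))))

  ∼-trans : ∀ {A B C} → A ∼ B → B ∼ C → A ∼ C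
  ∼-trans {C = C} (s , s#0 , A≋sB) (t , t#0 , B≋tC) =
    s * t , x#0y#0→xy#0 s#0 t#0 ,
    ≋-trans A≋sB (≋-trans (•-congˡ B≋tC) (•-assoc s t C))

  ⊗-cong-∼ : ∀ {A B C D} → A ∼ B → C ∼ D → A ⊗ C ∼ B ⊗ D
  ⊗-cong-∼ {B = B} {D = D} (s , s#0 , A≋sB) (t , t#0 , C≋tD) =
    s * t , x#0y#0→xy#0 s#0 t#0 , ≋-trans (⊗-cong A≋sB C≋tD) (•-⊗ s t B D)

  cancel-inverse : ∀ A A′ {B B′} → B ⊗ B′ ≋ I → A ⊗ A′ ≋ I → (A ⊗ B) ⊗ (B′ ⊗ A′) ≋ I
  cancel-inverse A A′ {B} {B′} BB′ AA′ =
    ≋-trans (⊗-assoc A B (B′ ⊗ A′))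
    (≋-trans (⊗-cong ≋-refl (≋-trans (≋-sym (⊗-assoc B B′ A′))
                            (≋-trans (⊗-cong BB′ ≋-refl) (⊗-identityˡ A′))))
             AA′)

  infixl 7 _∙ᴳ_
  _∙ᴳ_ : GL₂ → GL₂ → GL₂
  g ∙ᴳ h = record
    { matrix   = matrix g ⊗ matrix h
    ; inverse  = GL₂.inverse h ⊗ GL₂.inverse g
    ; inverseˡ = cancel-inverse (GL₂.inverse h) (matrix h) (GL₂.inverseˡ g) (GL₂.inverseˡ h)
    ; inverseʳ = cancel-inverse (matrix g) (GL₂.inverse g) (GL₂.inverseʳ h) (GL₂.inverseʳ g)
    }

  εᴳ : GL₂
  εᴳ = record
    { matrix = I ; inverse = I ; inverseˡ = ⊗-identityˡ I ; inverseʳ = ⊗-identityˡ I }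

  infix 8 _⁻¹ᴳ
  _⁻¹ᴳ : GL₂ → GL₂
  g ⁻¹ᴳ = record
    { matrix   = GL₂.inverse g
    ; inverse  = matrix g
    ; inverseˡ = GL₂.inverseʳ g
    ; inverseʳ = GL₂.inverseˡ g
    }

  ⁻¹-cong-∼ : ∀ g h → matrix g ∼ matrix h → GL₂.inverse g ∼ GL₂.inverse h
  ⁻¹-cong-∼ g h g∼h =
    ∼-trans (∼-sym (≋⇒∼ (⊗-identityʳ g⁻¹)))
    (∼-trans (⊗-cong-∼ ∼-refl (∼-sym (≋⇒∼ (GL₂.inverseʳ h))))
    (∼-trans (∼-sym (≋⇒∼ (⊗-assoc g⁻¹ (matrix h) h⁻¹)))
    (∼-trans (⊗-cong-∼ (∼-trans (⊗-cong-∼ ∼-refl (∼-sym g∼h)) (≋⇒∼ (GL₂.inverseˡ g))) ∼-refl)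
             (≋⇒∼ (⊗-identityˡ h⁻¹)))))
    where
    g⁻¹ = GL₂.inverse g
    h⁻¹ = GL₂.inverse h

  PGL₂ : Group (c ⊔ ℓ₁) (c ⊔ ℓ₁ ⊔ ℓ₂)
  PGL₂ = record
    { Carrier = GL₂
    ; _≈_     = λ g h → matrix g ∼ matrix h
    ; _∙_     = _∙ᴳ_
    ; ε       = εᴳ
    ; _⁻¹     = _⁻¹ᴳ
    ; isGroup = record
      { isMonoid = record
        { isSemigroup = record
          { isMagma = record
            { isEquivalence = record { refl = ∼-refl ; sym = ∼-sym ; trans = ∼-trans }
            ; ∙-cong = ⊗-cong-∼
            }
          ; assoc = λ g h k → ≋⇒∼ (⊗-assoc (matrix g) (matrix h) (matrix k))
          }
        ; identity = (λ g → ≋⇒∼ (⊗-identityˡ (matrix g))) , (λ g → ≋⇒∼ (⊗-identityʳ (matrix g)))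
        }
      ; inverse = (λ g → ≋⇒∼ (GL₂.inverseˡ g)) , (λ g → ≋⇒∼ (GL₂.inverseʳ g))
      ; ⁻¹-cong = λ {g} {h} → ⁻¹-cong-∼ g h
      }
    }

------------------------------------------------------------------------
-- The regular map of type (p,p)

module GeneratingTriple
         {c ℓ₁ ℓ₂} {p : ℕ} (p-prime : Prime p) (p-odd : ¬ (2 ∣ p))
         (K : HeytingField c ℓ₁ ℓ₂) (closure : IsAlgebraicClosureOfGF K p)
         (α : HeytingField.Carrier K) (α²≈-1 : SquareRootOfMinusOne K α) where

  open HeytingField K

  open PGL₂ K
  open HeytingCommutativeRing heytingCommutativeRing using (commutativeRing)
  open CommutativeRing commutativeRing using (ring; semiring)
  open HeytingProperties heytingCommutativeRing
    using (1#0; x-0≈x; invertibleʳ⇒#)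
  open RingProperties ring
    using (-‿distribˡ-*; -0#≈0#; -‿involutive; -1*x≈-x; -‿+-comm)
  open IsAlgebraicClosureOfGF closure using (characteristic)
  open SemiringMult semiring using (×1-homo-*)
  open SetoidReasoning setoid

  2# = 1# + 1#
  -1# = - 1#

  matrixX matrixY matrixZ : Matrix
  matrixX = (- α) • mat 1# 0#
                        2# -1#
  matrixY = (- α) • mat 1# -1#
                        0# -1#
  matrixZ = α • mat 1# 0#
                    0# -1#

  -- What follows checks that these matrices define a regular map of type
  -- (p , p), by reducing them modulo scalars to the matrices A, B, C.
  A B C : Matrix
  A = mat 1# 0# 2# -1#
  B = mat 1# -1# 0# -1#
  C = mat 1# 0# 0# -1#

  -1*-1≈1 : -1# * -1# ≈ 1#
  -1*-1≈1 = trans (-1*x≈-x -1#) (-‿involutive 1#)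

  0+-1*-1≈1 : ∀ {x} → 0# * x + -1# * -1# ≈ 1#
  0+-1*-1≈1 = trans (+-cong (zeroˡ _) -1*-1≈1) (+-identityˡ _)

  x*0+0*y≈0 : ∀ {x y} → x * 0# + 0# * y ≈ 0#
  x*0+0*y≈0 = trans (+-cong (zeroʳ _) (zeroˡ _)) (+-identityˡ _)

  0*x+y*0≈0 : ∀ {x y} → 0# * x + y * 0# ≈ 0#
  0*x+y*0≈0 = trans (+-cong (zeroˡ _) (zeroʳ _)) (+-identityˡ _)

  x*0+-1*-1≈1 : ∀ {x} → x * 0# + -1# * -1# ≈ 1#
  x*0+-1*-1≈1 = trans (+-cong (zeroʳ _) -1*-1≈1) (+-identityˡ _)

  x*1-x≈0 : ∀ {x} → x * 1# + -1# * x ≈ 0#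
  x*1-x≈0 = trans (+-cong (*-identityʳ _) (-1*x≈-x _)) (-‿inverseʳ _)

  1*-1-1*-1≈0 : 1# * -1# + -1# * -1# ≈ 0#
  1*-1-1*-1≈0 = trans (+-cong (*-identityˡ _) -1*-1≈1) (-‿inverseˡ _)

  AA≋I : A ⊗ A ≋ I
  AA≋I = mk≋ 1x+0y x*0+0*y≈0 x*1-x≈0 x*0+-1*-1≈1

  BB≋I : B ⊗ B ≋ I
  BB≋I = mk≋ x1+y0 1*-1-1*-1≈0 0*x+y*0≈0 0+-1*-1≈1

  CC≋I : C ⊗ C ≋ I
  CC≋I = mk≋ 1x+0y x*0+0*y≈0 0*x+y*0≈0 0+-1*-1≈1

  -α*α≈1 : (- α) * α ≈ 1#
  -α*α≈1 = trans (sym (-‿distribˡ-* α α)) (trans (-‿cong α²≈-1) (-‿involutive 1#))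

  α*-α≈1 : α * (- α) ≈ 1#
  α*-α≈1 = trans (*-comm _ _) -α*α≈1

  α#0 : α # 0#
  α#0 = invertibleʳ⇒# (- α , trans (*-congʳ (x-0≈x α)) α*-α≈1)

  -α#0 : (- α) # 0#
  -α#0 = invertibleʳ⇒# (α , trans (*-congʳ (x-0≈x (- α))) -α*α≈1)

  scaled : ∀ s t M → s * t ≈ 1# → M ⊗ M ≋ I → (s • M) ⊗ (t • M) ≋ I
  scaled s t M st≈1 MM≋I =
    ≋-trans (•-⊗ s t M M) (≋-trans (•-congʳ st≈1) (≋-trans (1•A≋A _) MM≋I))

  glX glY glZ : GL₂
  glX = record
    { matrix   = matrixX
    ; inverse  = α • A
    ; inverseˡ = scaled α (- α) A α*-α≈1 AA≋I
    ; inverseʳ = scaled (- α) α A -α*α≈1 AA≋I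
    }
  glY = record
    { matrix   = matrixY
    ; inverse  = α • B
    ; inverseˡ = scaled α (- α) B α*-α≈1 BB≋I
    ; inverseʳ = scaled (- α) α B -α*α≈1 BB≋I
    }
  glZ = record
    { matrix   = matrixZ
    ; inverse  = (- α) • C
    ; inverseˡ = scaled (- α) α C -α*α≈1 CC≋I
    ; inverseʳ = scaled α (- α) C α*-α≈1 CC≋I
    }

  group⟨X,Y,Z⟩ : Group (c ⊔ ℓ₁ ⊔ ℓ₂) (c ⊔ ℓ₁ ⊔ ℓ₂)
  group⟨X,Y,Z⟩ = subgroupGeneratedBy PGL₂ glX glY glZ

  module G = Group group⟨X,Y,Z⟩

  X Y Z : G.Carrier
  X = glX , Generated.genX
  Y = glY , Generated.genY
  Z = glZ , Generated.genZ

  ⟪_⟫ : G.Carrier → Matrix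
  ⟪ g , _ ⟫ = matrix g

  generates : ∀ g (w : Generated PGL₂ glX glY glZ g) →
              Generated group⟨X,Y,Z⟩ X Y Z (g , w)
  generates _ Generated.genX               = genX
  generates _ Generated.genY               = genY
  generates _ Generated.genZ               = genZ
  generates _ Generated.unit               = unit
  generates _ (Generated.mul v w)          = mul (generates _ v) (generates _ w)
  generates _ (Generated.inv w)            = inv (generates _ w)
  generates _ (Generated.resp {g} {h} e w) =
    resp {g = g , w} {h = h , resp {g = g} {h = h} e w} e (generates _ w)

  -- Non-vanishing in K.
  1≉0 : ¬ (1# ≈ 0#)
  1≉0 1≈0 = #-irrefl 1≈0 1#0

  -1≉0 : ¬ (-1# ≈ 0#)
  -1≉0 -1≈0 = 1≉0 (trans (sym (-‿involutive 1#)) (trans (-‿cong -1≈0) -0#≈0#))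

  2*h≈-1 : ∃ λ h → 2# * h ≈ -1#
  2*h≈-1 = fromℕ K (p / 2) , (begin
    2# * fromℕ K (p / 2)                     ≈⟨ *-comm _ _ ⟩
    fromℕ K (p / 2) * 2#                     ≈⟨ *-congˡ (+-congˡ (+-identityʳ 1#)) ⟨
    fromℕ K (p / 2) * fromℕ K 2              ≈⟨ ×1-homo-* (p / 2) 2 ⟨
    fromℕ K (p / 2 ℕ.* 2)                    ≈⟨ +-identityˡ _ ⟨
    0# + fromℕ K (p / 2 ℕ.* 2)               ≈⟨ +-congʳ (-‿inverseˡ 1#) ⟨
    (-1# + 1#) + fromℕ K (p / 2 ℕ.* 2)       ≈⟨ +-assoc _ _ _ ⟩
    -1# + fromℕ K (1 ℕ.+ p / 2 ℕ.* 2)        ≡⟨ ≡.cong (λ n → -1# + fromℕ K n) p≡ ⟨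
    -1# + fromℕ K p                            ≈⟨ +-congˡ (Equivalence.from (characteristic p) ∣-refl) ⟩
    -1# + 0#                                   ≈⟨ +-identityʳ _ ⟩
    -1#                                        ∎)
    where
    p%2≡1 : p % 2 ≡ 1
    p%2≡1 with p % 2 in eq | m%n<n p 2
    ... | 0           | _             = contradiction (m%n≡0⇒n∣m p 2 eq) p-odd
    ... | 1           | _             = ≡.refl
    ... | suc (suc _) | s≤s (s≤s ())

    p≡ : p ≡ 1 ℕ.+ p / 2 ℕ.* 2
    p≡ = ≡.trans (m≡m%n+[m/n]*n p 2) (≡.cong (ℕ._+ p / 2 ℕ.* 2) p%2≡1)

  2x≈0⇒x≈0 : ∀ {x} → x * 2# ≈ 0# → x ≈ 0#
  2x≈0⇒x≈0 {x} 2x≈0 with 2*h≈-1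
  ... | h , 2h≈-1 = begin
    x              ≈⟨ -‿involutive x ⟨
    - (- x)        ≈⟨ -‿cong (-1*x≈-x x) ⟨
    - (-1# * x)    ≈⟨ -‿cong (*-comm _ _) ⟩
    - (x * -1#)    ≈⟨ -‿cong (*-congˡ 2h≈-1) ⟨
    - (x * (2# * h)) ≈⟨ -‿cong (*-assoc x 2# h) ⟨
    - (x * 2# * h) ≈⟨ -‿cong (trans (*-congʳ 2x≈0) (zeroˡ h)) ⟩
    - 0#           ≈⟨ -0#≈0# ⟩
    0#             ∎

  2≉0 : ¬ (2# ≈ 0#)
  2≉0 2≈0 = 1≉0 (2x≈0⇒x≈0 (trans (*-identityˡ 2#) 2≈0))

  -- A matrix proportional to I is diagonal with equal diagonal entries.
  ∼I⇒e₁₂ : ∀ {M} → M ∼ I → m₁₂ M ≈ 0#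
  ∼I⇒e₁₂ (_ , _ , e) = trans (e₁₂ e) (zeroʳ _)

  ∼I⇒e₂₁ : ∀ {M} → M ∼ I → m₂₁ M ≈ 0#
  ∼I⇒e₂₁ (_ , _ , e) = trans (e₂₁ e) (zeroʳ _)

  ∼I⇒diag : ∀ {M} → M ∼ I → m₁₁ M ≈ m₂₂ M
  ∼I⇒diag (_ , _ , e) = trans (e₁₁ e) (sym (e₂₂ e))

  A≁I : ¬ (A ∼ I)
  A≁I e = 2≉0 (∼I⇒e₂₁ e)

  B≁I : ¬ (B ∼ I)
  B≁I e = -1≉0 (∼I⇒e₁₂ e)

  C≁I : ¬ (C ∼ I)
  C≁I e = 2≉0 (trans (+-congʳ (∼I⇒diag e)) (-‿inverseˡ 1#))

  order2 : ∀ g {M} → ⟪ g ⟫ ∼ M → M ⊗ M ∼ I → ¬ (M ∼ I) → HasOrder group⟨X,Y,Z⟩ g 2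
  order2 g {M} g∼M MM∼I M≁I = record
    { positive = s≤s z≤n
    ; power    = ∼-trans (⊗-cong-∼ g∼M (∼-trans (≋⇒∼ (⊗-identityʳ _)) g∼M)) MM∼I
    ; minimal  = minimal
    }
    where
    minimal : ∀ m → 0 < m → m < 2 → ¬ (⟪ _^_ group⟨X,Y,Z⟩ g m ⟫ ∼ I)
    minimal 1 _ _ e =
      M≁I (∼-trans (∼-sym g∼M) (∼-trans (∼-sym (≋⇒∼ (⊗-identityʳ _))) e))
    minimal (suc (suc _)) _ (s≤s (s≤s ()))

  -- Transvections.
  U : Carrier → Matrix
  U x = mat 1# x 0# 1#

  L : Carrier → Matrix
  L x = mat 1# 0# x 1#

  UU : ∀ x y → U x ⊗ U y ≋ U (x + y)
  UU x y = mk≋ x1+y0 (trans (+-cong (*-identityˡ _) (*-identityʳ _)) (+-comm _ _))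
               0*x+y*0≈0 0x+1y

  LL : ∀ x y → L x ⊗ L y ≋ L (x + y)
  LL x y = mk≋ 1x+0y x*0+0*y≈0 (+-cong (*-identityʳ _) (*-identityˡ _)) x0+y1

  power : ∀ (T : Carrier → Matrix) → (∀ x y → T x ⊗ T y ≋ T (x + y)) →
          (∀ {x y} → x ≈ y → T x ≋ T y) → T 0# ≋ I →
          ∀ g x → ⟪ g ⟫ ∼ T x →
          ∀ n → ⟪ _^_ group⟨X,Y,Z⟩ g n ⟫ ∼ T (fromℕ K n * x)
  power T TT T-cong T0 g x g∼T 0 =
    ≋⇒∼ (≋-trans (≋-sym T0) (T-cong (sym (zeroˡ x))))
  power T TT T-cong T0 g x g∼T (suc n) =
    ∼-trans (⊗-cong-∼ g∼T (power T TT T-cong T0 g x g∼T n))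
            (≋⇒∼ (≋-trans (TT _ _) (T-cong (trans (+-congʳ (sym (*-identityˡ x)))
                                                (sym (distribʳ x 1# (fromℕ K n)))))))

  orderP : ∀ (T : Carrier → Matrix) → (∀ x y → T x ⊗ T y ≋ T (x + y)) →
           (∀ {x y} → x ≈ y → T x ≋ T y) → T 0# ≋ I → (∀ {x} → T x ∼ I → x ≈ 0#) →
           ∀ g x → ⟪ g ⟫ ∼ T x → (∀ {y} → y * x ≈ 0# → y ≈ 0#) →
           HasOrder group⟨X,Y,Z⟩ g p
  orderP T TT T-cong T0 T⇒0 g x g∼T x-cancel = record
    { positive = ℕ.>-nonZero⁻¹ p {{prime⇒nonZero p-prime}}
    ; power    = ∼-trans (pow p) (≋⇒∼ (≋-trans (T-cong px≈0) T0))
    ; minimal  = λ m 0<m m<p e →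
        let p∣m = Equivalence.to (characteristic m)
                    (x-cancel (T⇒0 (∼-trans (∼-sym (pow m)) e)))
        in ℕ.<⇒≱ m<p (∣⇒≤ {{ℕ.>-nonZero 0<m}} p∣m)
    }
    where
    pow = power T TT T-cong T0 g x g∼T
    px≈0 : fromℕ K p * x ≈ 0#
    px≈0 = trans (*-congʳ (Equivalence.from (characteristic p) ∣-refl)) (zeroˡ x)

  X∼A : ⟪ X ⟫ ∼ A
  X∼A = •∼ -α#0

  Y∼B : ⟪ Y ⟫ ∼ B
  Y∼B = •∼ -α#0

  Z∼C : ⟪ Z ⟫ ∼ C
  Z∼C = •∼ α#0

  AB : Matrix
  AB = mat 1# -1# 2# -1#

  A⊗B≋AB : A ⊗ B ≋ AB
  A⊗B≋AB = mk≋ 1x+0y 1x+0y x1+y0 (begin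
    2# * -1# + -1# * -1#           ≈⟨ +-cong (trans (distribʳ _ _ _) (+-cong (*-identityˡ _) (*-identityˡ _))) -1*-1≈1 ⟩
    (-1# + -1#) + 1#               ≈⟨ +-assoc _ _ _ ⟩
    -1# + (-1# + 1#)               ≈⟨ +-congˡ (-‿inverseˡ 1#) ⟩
    -1# + 0#                       ≈⟨ +-identityʳ _ ⟩
    -1#                            ∎)

  ABAB≋-I : AB ⊗ AB ≋ -1# • I
  ABAB≋-I = mk≋
    (begin
      1# * 1# + -1# * 2#           ≈⟨ +-cong (*-identityˡ _) (-1*x≈-x 2#) ⟩
      1# + - 2#                    ≈⟨ +-congˡ (-‿+-comm 1# 1#) ⟨
      1# + (-1# + -1#)             ≈⟨ +-assoc _ _ _ ⟨
      (1# + -1#) + -1#             ≈⟨ +-congʳ (-‿inverseʳ 1#) ⟩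
      0# + -1#                     ≈⟨ +-identityˡ _ ⟩
      -1#                          ≈⟨ *-identityʳ _ ⟨
      -1# * 1#                     ∎)
    (trans 1*-1-1*-1≈0 (sym (zeroʳ _)))
    (trans x*1-x≈0 (sym (zeroʳ _)))
    (trans (e₂₂ A⊗B≋AB) (sym (*-identityʳ _)))

  -1#0 : -1# # 0#
  -1#0 = invertibleʳ⇒# (-1# , trans (*-congʳ (x-0≈x -1#)) -1*-1≈1)

  B⊗C≋U : B ⊗ C ≋ U 1#
  B⊗C≋U = mk≋ x1+y0 (trans (+-cong (zeroʳ _) -1*-1≈1) (+-identityˡ _))
              0*x+y*0≈0 0+-1*-1≈1

  C⊗A≋L : C ⊗ A ≋ L (-1# * 2#)
  C⊗A≋L = mk≋ 1x+0y x*0+0*y≈0 (trans (+-congʳ (zeroˡ _)) (+-identityˡ _)) 0+-1*-1≈1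

  -2-cancel : ∀ {y} → y * (-1# * 2#) ≈ 0# → y ≈ 0#
  -2-cancel {y} e =
    trans (sym (-‿involutive y))
      (trans (-‿cong (2x≈0⇒x≈0 (trans (*-congʳ -y≈y*-1) (trans (*-assoc y -1# 2#) e)))) -0#≈0#)
    where
    -y≈y*-1 : - y ≈ y * -1#
    -y≈y*-1 = trans (sym (-1*x≈-x y)) (*-comm _ _)

  regularMap : RegularMap p p (c ⊔ ℓ₁ ⊔ ℓ₂) (c ⊔ ℓ₁ ⊔ ℓ₂)
  regularMap = record
    { group      = group⟨X,Y,Z⟩
    ; X          = X
    ; Y          = Y
    ; Z          = Z
    ; generating = λ (g , w) → generates g w
    ; orderX     = order2 X X∼A (≋⇒∼ AA≋I) A≁I
    ; orderY     = order2 Y Y∼B (≋⇒∼ BB≋I) B≁I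
    ; orderZ     = order2 Z Z∼C (≋⇒∼ CC≋I) C≁I
    ; orderXY    = order2 (X G.∙ Y) (∼-trans (⊗-cong-∼ X∼A Y∼B) (≋⇒∼ A⊗B≋AB))
                     (-1# , -1#0 , ABAB≋-I) (λ e → -1≉0 (∼I⇒e₁₂ e))
    ; orderYZ    = orderP U UU (λ e → mk≋ refl e refl refl) ≋-refl ∼I⇒e₁₂ (Y G.∙ Z) 1#
                     (∼-trans (⊗-cong-∼ Y∼B Z∼C) (≋⇒∼ B⊗C≋U))
                     (λ e → trans (sym (*-identityʳ _)) e)
    ; orderZX    = orderP L LL (λ e → mk≋ refl refl e refl) ≋-refl ∼I⇒e₂₁ (Z G.∙ X) (-1# * 2#)
                     (∼-trans (⊗-cong-∼ Z∼C X∼A) (≋⇒∼ C⊗A≋L)) -2-cancel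
    }

{-# OPTIONS --safe #-}

-- A Petrie duality φ sends ZX to Z(XY), so Z(XY) would have order p. But
-- modulo scalars Z(XY) is (1 -1 ; -2 1), with eigenvectors (1 , ±r) and
-- eigenvalues 1 ∓ r, where r² = 2. If its p-th power is scalar, then the p-th
-- powers of the two eigenvalues agree; since the Frobenius map is injective,
-- r = -r, which is impossible in odd characteristic.
module Submission where

open import Defs renaming (_^_ to _^ᴳ_)
open import Algebra.Apartness.Bundles using (HeytingField; HeytingCommutativeRing)
open import Algebra.Bundles using (Group; CommutativeRing; CommutativeSemiring)
open import Algebra.Morphism.Structures using (module GroupMorphisms)
import Algebra.Apartness.Properties.HeytingCommutativeRing as HeytingProperties
import Algebra.Properties.CommutativeSemiring.Binomial as Binomial
import Algebra.Properties.Group as GroupProperties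
import Algebra.Properties.Monoid.Mult as MonoidMult
import Algebra.Properties.Ring as RingProperties
import Algebra.Properties.Semiring.Exp as Exp
import Algebra.Properties.Semiring.Mult as Mult
import Algebra.Properties.Semiring.Sum as Sum
open import Data.Fin.Base as Fin using (toℕ; inject₁)
open import Data.Fin.Properties using (toℕ-fromℕ; toℕ-inject₁; toℕ<n)
open import Data.Nat.Base as ℕ using (ℕ; zero; suc; _!; _∸_; z<s; s<s)
open import Data.Nat.Combinatorics using (_C_; nCn≡1; k![n∸k]!∣n!)
open import Data.Nat.Combinatorics.Specification using (nCk≡n!/k![n-k]!)
open import Data.Nat.DivMod using (m/n*n≡m)
open import Data.Nat.Divisibility using (_∣_; divides; ∣⇒≤; ∣-refl; m∣m*n)
open import Data.Nat.Primality using (Prime; ¬prime[0]; prime⇒nonZero; prime⇒nonTrivial; euclidsLemma)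
import Data.Nat.Properties as ℕ
open import Data.Product.Base using (∃; _,_; proj₁)
open import Data.Sum.Base using (inj₁; inj₂)
open import Data.Vec.Base using ([]; _∷_)
open import Function.Bundles using (module Equivalence)
open import Relation.Binary.PropositionalEquality as ≡ using (_≡_)
import Relation.Binary.Reasoning.Setoid as SetoidReasoning
open import Relation.Nullary using (¬_; contradiction)

-- Prime divisors of factorials and binomial coefficients.

prime∣n!⇒≤ : ∀ {p} → Prime p → ∀ n → p ∣ n ! → p ℕ.≤ n
prime∣n!⇒≤ p-prime zero p∣1 =
  contradiction (∣⇒≤ p∣1) (ℕ.<⇒≱ (ℕ.nonTrivial⇒n>1 _ {{prime⇒nonTrivial p-prime}}))
prime∣n!⇒≤ p-prime (suc n) p∣ with euclidsLemma (suc n) (n !) p-prime p∣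
... | inj₁ p∣1+n = ∣⇒≤ p∣1+n
... | inj₂ p∣n!  = ℕ.m≤n⇒m≤1+n (prime∣n!⇒≤ p-prime n p∣n!)

-- `p` divides `p ! = (p C k) * (k ! * (p ∸ k) !)`, and neither factorial, because `k` and `p ∸ k`
-- are both below `p`.
prime∣pCk : ∀ {p k} → Prime p → 0 ℕ.< k → k ℕ.< p → p ∣ p C k
prime∣pCk {p@(suc q)} {k} p-prime 0<k k<p
  with euclidsLemma (p C k) (k ! ℕ.* (p ∸ k) !) p-prime p∣product
  where
  instance _ = ℕ.m*n≢0 (k !) ((p ∸ k) !) {{k ℕ.!≢0}} {{(p ∸ k) ℕ.!≢0}}

  p∣product : p ∣ (p C k) ℕ.* (k ! ℕ.* (p ∸ k) !)
  p∣product = ≡.subst (p ∣_)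
    (≡.sym (≡.trans (≡.cong (ℕ._* (k ! ℕ.* (p ∸ k) !)) (nCk≡n!/k![n-k]! (ℕ.<⇒≤ k<p)))
                    (m/n*n≡m (k![n∸k]!∣n! (ℕ.<⇒≤ k<p)))))
    -- `p !` computes to `p * q !`, as `p` is `suc q`.
    (m∣m*n (q !))
... | inj₁ p∣C = p∣C
... | inj₂ p∣k![p-k]! with euclidsLemma (k !) ((p ∸ k) !) p-prime p∣k![p-k]!
...   | inj₁ p∣k!     = contradiction (prime∣n!⇒≤ p-prime k p∣k!) (ℕ.<⇒≱ k<p)
...   | inj₂ p∣[p-k]! = contradiction (prime∣n!⇒≤ p-prime (p ∸ k) p∣[p-k]!)
                          (ℕ.<⇒≱ (ℕ.∸-monoʳ-< 0<k (ℕ.<⇒≤ k<p)))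

-- Additivity of the Frobenius map.

module _ {c ℓ} (R : CommutativeSemiring c ℓ) where

  open CommutativeSemiring R
  open Binomial R using (binomialTerm; binomial; theorem)
  open Exp semiring using (_^_)
  open Mult semiring renaming (_×_ to _·_)
  open Sum semiring using (sum; sum-cong-≋; sum-init-last; sum-replicate-zero)
  open SetoidReasoning setoid

  -- In the binomial expansion only the two outer terms survive, since every other coefficient is a
  -- multiple of `p`.
  frobenius-+ : ∀ {p} → Prime p → p · 1# ≈ 0# → ∀ x y → (x + y) ^ p ≈ x ^ p + y ^ p
  frobenius-+ {zero}      p-prime p·1≈0 x y = contradiction p-prime ¬prime[0]
  frobenius-+ {p@(suc q)} p-prime p·1≈0 x y = begin
    (x + y) ^ p                                   ≈⟨ theorem p x y ⟩
    sum t                                         ≡⟨⟩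
    -- Both ends are split off the `suc p` terms; the remaining `inner` ones have `k` from `1` to
    -- `q = p ∸ 1`.
    t Fin.zero + sum (λ i → t (Fin.suc i))        ≈⟨ +-congˡ (sum-init-last (λ i → t (Fin.suc i))) ⟩
    t Fin.zero + (sum inner + t (Fin.fromℕ p))    ≈⟨ +-cong first (+-cong (trans (sum-cong-≋ inner≈0) (sum-replicate-zero q)) last) ⟩
    y ^ p + (0# + x ^ p)                          ≈⟨ +-congˡ (+-identityˡ _) ⟩
    y ^ p + x ^ p                                 ≈⟨ +-comm _ _ ⟩
    x ^ p + y ^ p                                 ∎
    where
    t = binomialTerm x y p

    inner : Fin.Fin q → Carrier
    inner i = t (Fin.suc (inject₁ i))

    first : t Fin.zero ≈ y ^ p
    first = trans (×-homo-1 _) (*-identityˡ _)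

    last : t (Fin.fromℕ p) ≈ x ^ p
    -- The rewrites turn the coefficient into `1` and the exponent of `y` into `0`.
    last rewrite toℕ-fromℕ q | nCn≡1 p | ℕ.n∸n≡0 q = trans (×-homo-1 _) (*-identityʳ _)

    ∣⇒·≈0 : ∀ {n} → p ∣ n → ∀ z → n · z ≈ 0#
    ∣⇒·≈0 (divides m ≡.refl) z = begin
      (m ℕ.* p) · z               ≈⟨ ×-congʳ (m ℕ.* p) (*-identityˡ z) ⟨
      (m ℕ.* p) · (1# * z)        ≈⟨ ×-assoc-* (m ℕ.* p) 1# z ⟨
      ((m ℕ.* p) · 1#) * z        ≈⟨ *-congʳ (×1-homo-* m p) ⟩
      (m · 1#) * (p · 1#) * z     ≈⟨ *-congʳ (trans (*-congˡ p·1≈0) (zeroʳ _)) ⟩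
      0# * z                      ≈⟨ zeroˡ z ⟩
      0#                          ∎

    inner≈0 : ∀ i → inner i ≈ 0#
    inner≈0 i = ∣⇒·≈0 (prime∣pCk p-prime z<s
      (s<s (≡.subst (ℕ._< q) (≡.sym (toℕ-inject₁ i)) (toℕ<n i)))) (binomial x y p (Fin.suc (inject₁ i)))

-- Transport of power relations along homomorphisms.

module _ {c₁ ℓ₁ c₂ ℓ₂} (G : Group c₁ ℓ₁) (H : Group c₂ ℓ₂) where

  private
    module G = Group G
    module H = Group H

  open GroupMorphisms G.rawGroup H.rawGroup using (IsGroupHomomorphism)

  ^-homo : ∀ {φ} → IsGroupHomomorphism φ → ∀ g n → φ (_^ᴳ_ G g n) H.≈ _^ᴳ_ H (φ g) n
  ^-homo isHom g zero    = IsGroupHomomorphism.ε-homo isHom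
  ^-homo isHom g (suc n) =
    H.trans (IsGroupHomomorphism.homo isHom g (_^ᴳ_ G g n)) (H.∙-congˡ (^-homo isHom g n))

module _ {k l c ℓ} (M : RegularMap k l c ℓ) where

  open RegularMap M
  open SetoidReasoning setoid

  -- Homomorphisms preserve relations: `φ` turns `(Z ∙ X) ^ l ≈ ε` into the same relation for
  -- `φ Z ∙ φ X`.
  petrie-power : SelfPetrieDual M → _^ᴳ_ group (Z ∙ (X ∙ Y)) l ≈ ε
  petrie-power dual = begin
    _^ᴳ_ group (Z ∙ (X ∙ Y)) l ≈⟨ ×-congʳ l (∙-cong φZ≈Z φX≈XY) ⟨
    _^ᴳ_ group (φ Z ∙ φ X) l   ≈⟨ ×-congʳ l (homo Z X) ⟨
    _^ᴳ_ group (φ (Z ∙ X)) l   ≈⟨ ^-homo group group isGroupHomomorphism (Z ∙ X) l ⟨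
    φ (_^ᴳ_ group (Z ∙ X) l)   ≈⟨ ⟦⟧-cong (HasOrder.power orderZX) ⟩
    φ ε                        ≈⟨ ε-homo ⟩
    ε                          ∎
    where
    open SelfPetrieDual dual
    open GroupMorphisms rawGroup rawGroup using (IsGroupHomomorphism; IsGroupIsomorphism)
    open IsGroupIsomorphism isAutomorphism using (isGroupHomomorphism)
    open IsGroupHomomorphism isGroupHomomorphism using (homo; ε-homo; ⟦⟧-cong)
    open MonoidMult monoid using (×-congʳ)

module _ {c ℓ} (G : Group c ℓ) (X Y Z : Group.Carrier G) where

  private
    module G = Group G
    module S = Group (subgroupGeneratedBy G X Y Z)

  -- The inclusion of the subgroup is a homomorphism. This moves the torsion relation to `PGL₂`,
  -- where powers are powers of matrices.
  subgroup-torsion : ∀ g n → _^ᴳ_ (subgroupGeneratedBy G X Y Z) g n S.≈ S.ε →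
                     _^ᴳ_ G (proj₁ g) n G.≈ G.ε
  subgroup-torsion g n g^n≈ε =
    G.trans (G.sym (^-homo (subgroupGeneratedBy G X Y Z) G proj₁-homo g n)) g^n≈ε
    where
    proj₁-homo : GroupMorphisms.IsGroupHomomorphism S.rawGroup G.rawGroup proj₁
    proj₁-homo = record
      { isMonoidHomomorphism = record
        { isMagmaHomomorphism = record
          { isRelHomomorphism = record { cong = λ e → e }
          ; homo = λ _ _ → G.refl
          }
        ; ε-homo = G.refl
        }
      ; ⁻¹-homo = λ _ → G.refl
      }

-- Frobenius injectivity and eigenvalues of torsion elements.

module _ {c ℓ₁ ℓ₂} (K : HeytingField c ℓ₁ ℓ₂) where

  open HeytingField K
  open HeytingCommutativeRing heytingCommutativeRing using (commutativeRing)
  open CommutativeRing commutativeRing using (semiring; commutativeSemiring; +-group)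
  open HeytingProperties heytingCommutativeRing using (1#0; x#0y#0→xy#0)
  open GroupProperties +-group using (∙-cancelʳ; x∙y⁻¹≈ε⇒x≈y)
  open Exp semiring using (_^_; ^-congˡ)
  open SetoidReasoning setoid

  x#0⇒x^n#0 : ∀ {x} → x # 0# → ∀ n → x ^ n # 0#
  x#0⇒x^n#0 x#0 zero    = 1#0
  x#0⇒x^n#0 x#0 (suc n) = x#0y#0→xy#0 x#0 (x#0⇒x^n#0 x#0 n)

  x^n≈0⇒x≈0 : ∀ {x} n → x ^ n ≈ 0# → x ≈ 0#
  x^n≈0⇒x≈0 {x} n x^n≈0 =
    -- Apartness is tight, so it is enough to refute `x # 0#`; powers of an element apart from zero
    -- stay apart from zero.
    proj₁ (tight x 0#) λ x#0 → #-irrefl x^n≈0 (x#0⇒x^n#0 x#0 n)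

  -- Additivity is applied to the sum `(x - y) + y`, which avoids computing `(- y) ^ p`. It gives
  -- `(x - y) ^ p ≈ 0#`, hence `x - y ≈ 0#`.
  frobenius-injective : ∀ {p} → Prime p → fromℕ K p ≈ 0# → ∀ {x y} → x ^ p ≈ y ^ p → x ≈ y
  frobenius-injective {p} p-prime p≈0 {x} {y} x^p≈y^p =
    x∙y⁻¹≈ε⇒x≈y x y (x^n≈0⇒x≈0 p (∙-cancelʳ (y ^ p) _ _ (begin
      (x - y) ^ p + y ^ p ≈⟨ frobenius-+ commutativeSemiring p-prime p≈0 (x - y) y ⟨
      (x - y + y) ^ p     ≈⟨ ^-congˡ p x-y+y≈x ⟩
      x ^ p               ≈⟨ x^p≈y^p ⟩
      y ^ p               ≈⟨ +-identityˡ _ ⟨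
      0# + y ^ p          ∎)))
    where
    x-y+y≈x : x - y + y ≈ x
    x-y+y≈x = trans (+-assoc _ _ _) (trans (+-congˡ (-‿inverseˡ y)) (+-identityʳ x))

  open PGL₂ K

  -- The column (1 , w) is doubled, so that eigenvectors are handled by the
  -- algebra of 2 × 2 matrices.
  column : Carrier → Matrix
  column w = mat 1# 1#
                 w  w

  -- Equality is `≋` and not `∼`, because rescaling a matrix rescales its eigenvalues.
  Eigen : Carrier → Carrier → Matrix → Set ℓ₁
  Eigen w x M = M ⊗ column w ≋ x • column w

  module _ {w : Carrier} where

    eigen-resp : ∀ {x M N} → M ≋ N → Eigen w x N → Eigen w x M
    eigen-resp M≋N e = ≋-trans (⊗-cong M≋N ≋-refl) e

    eigen-• : ∀ t {x M} → Eigen w x M → Eigen w (t * x) (t • M)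
    eigen-• t {x} {M} e =
      -- `•-⊗` expects a scalar on both factors, so the column receives `1#`.
      ≋-trans (⊗-cong ≋-refl (≋-sym (1•A≋A _)))
      (≋-trans (•-⊗ t 1# M (column w))
      (≋-trans (•-congʳ (*-identityʳ t))
      (≋-trans (•-congˡ e) (•-assoc t x _))))

    eigen-⊗ : ∀ {x y M N} → Eigen w x M → Eigen w y N → Eigen w (x * y) (M ⊗ N)
    eigen-⊗ {x} {y} {M} {N} e f =
      ≋-trans (⊗-assoc M N (column w))
      (≋-trans (⊗-cong (≋-sym (1•A≋A M)) f)
      (≋-trans (•-⊗ 1# y M (column w))
      (≋-trans (•-congʳ (*-identityˡ y))
      (≋-trans (•-congˡ e)
      (≋-trans (•-assoc y x _) (•-congʳ (*-comm y x)))))))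

    eigen-I : Eigen w 1# I
    eigen-I = ≋-trans (⊗-identityˡ _) (≋-sym (1•A≋A _))

    eigen-^ : ∀ {x} g → Eigen w x (matrix g) → ∀ n → Eigen w (x ^ n) (matrix (_^ᴳ_ PGL₂ g n))
    eigen-^ g e zero    = eigen-I
    eigen-^ g e (suc n) = eigen-⊗ e (eigen-^ g e n)

    -- The top entries of `column w` are `1#`, so the eigenvalue can be read off the first row.
    eigen-unique : ∀ {x y M} → Eigen w x M → Eigen w y M → x ≈ y
    eigen-unique {x} {y} e f = begin
      x      ≈⟨ *-identityʳ x ⟨
      x * 1# ≈⟨ trans (sym (e₁₁ e)) (e₁₁ f) ⟩
      y * 1# ≈⟨ *-identityʳ y ⟩
      y      ∎

  -- For `M ≋ s • I` every column is an eigenvector with the same eigenvalue, so `v` and `w` may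
  -- differ.
  eigenvalues-scalar : ∀ {v w x y M} → M ∼ I → Eigen v x M → Eigen w y M → x ≈ y
  eigenvalues-scalar (s , _ , M≋sI) e f =
    trans (eigen-unique e (eigen-resp M≋sI (eigen-• s eigen-I)))
          (eigen-unique (eigen-resp M≋sI (eigen-• s eigen-I)) f)

  -- The representative of `g` is `t • M` with unknown `t`, so the eigenvalues of its `p`-th power
  -- are `(t * x) ^ p` and `(t * y) ^ p`. These agree because that power is scalar; Frobenius
  -- injectivity gives `t * x ≈ t * y`, and the invertible `t` cancels.
  torsion⇒eigenvalues≈ : ∀ {p} → Prime p → fromℕ K p ≈ 0# →
    ∀ g {M} → matrix g ∼ M → matrix (_^ᴳ_ PGL₂ g p) ∼ I →
    ∀ {v w x y} → Eigen v x M → Eigen w y M → x ≈ y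
  torsion⇒eigenvalues≈ {p} p-prime p≈0 g (t , t#0 , g≋tM) g^p∼I {x = x} {y} e f
    with x#0⇒inverse t#0
  ... | u , _ , ut≈1 = begin
    x           ≈⟨ u*t*z≈z ⟨
    u * (t * x) ≈⟨ *-congˡ (frobenius-injective p-prime p≈0
                     (eigenvalues-scalar g^p∼I (power e) (power f))) ⟩
    u * (t * y) ≈⟨ u*t*z≈z ⟩
    y           ∎
    where
    u*t*z≈z : ∀ {z} → u * (t * z) ≈ z
    u*t*z≈z = trans (sym (*-assoc _ _ _)) (trans (*-congʳ ut≈1) (*-identityˡ _))

    power : ∀ {w z} → Eigen w z _ → Eigen w ((t * z) ^ p) _
    power e = eigen-^ g (eigen-resp g≋tM (eigen-• t e)) p

-- The element `ZXY` and its eigenvalues.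

module _ {c ℓ₁ ℓ₂} {p : ℕ} (p-prime : Prime p) (p-odd : ¬ (2 ∣ p))
         (K : HeytingField c ℓ₁ ℓ₂) (closure : IsAlgebraicClosureOfGF K p)
         (α : HeytingField.Carrier K) (α²≈-1 : SquareRootOfMinusOne K α) where

  open HeytingField K
  open PGL₂ K
  open HeytingCommutativeRing heytingCommutativeRing using (commutativeRing)
  open CommutativeRing commutativeRing using (ring; +-group)
  open RingProperties ring
    using (-‿distribˡ-*; -‿distribʳ-*; -‿involutive; -1*x≈-x)
  open GroupProperties +-group using (∙-cancelˡ; x∙y⁻¹≈ε⇒x≈y)
  open IsAlgebraicClosureOfGF closure
  open GeneratingTriple p-prime p-odd K closure α α²≈-1
  open SetoidReasoning setoid

  √2 : ∃ λ r → r * r ≈ 2#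
  -- The vector encodes `t² - 2`: constant term first, leading coefficient implicit, degree `suc 1`.
  √2 with algebraicallyClosed 1 (- 2# ∷ 0# ∷ [])
  ... | r , e = r , x∙y⁻¹≈ε⇒x≈y _ _ (begin
    r * r - 2#                       ≈⟨ +-comm _ _ ⟩
    - 2# + r * r                     ≈⟨ +-congˡ (*-congˡ (trans (+-identityˡ _) (*-identityʳ r))) ⟨
    - 2# + r * (0# + r * 1#)         ≈⟨ e ⟩
    0#                               ∎)

  CAB : Matrix
  CAB = mat 1# -1# (- 2#) 1#

  C⊗AB≋CAB : C ⊗ AB ≋ CAB
  C⊗AB≋CAB = mk≋ 1x+0y 1x+0y
    (trans (+-congʳ (zeroˡ _)) (trans (+-identityˡ _) (-1*x≈-x 2#))) 0+-1*-1≈1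

  -- Stated for an arbitrary square root of `2#`, so that it applies to `r` and to `- r`. The second
  -- row needs `- 2# + r ≈ (1# - r) * r`, which is where `r * r ≈ 2#` enters.
  eigen-CAB : ∀ {r} → r * r ≈ 2# → Eigen K r (1# - r) CAB
  eigen-CAB {r} r²≈2 = mk≋ top top bottom bottom
    where
    top : 1# * 1# + -1# * r ≈ (1# - r) * 1#
    top = trans (+-cong (*-identityˡ 1#) (-1*x≈-x r)) (sym (*-identityʳ _))

    bottom : - 2# * 1# + 1# * r ≈ (1# - r) * r
    bottom = begin
      - 2# * 1# + 1# * r   ≈⟨ +-congʳ (*-identityʳ _) ⟩
      - 2# + 1# * r        ≈⟨ +-congʳ (-‿cong r²≈2) ⟨
      - (r * r) + 1# * r   ≈⟨ +-comm _ _ ⟩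
      1# * r + - (r * r)   ≈⟨ +-congˡ (-‿distribˡ-* r r) ⟩
      1# * r + (- r) * r   ≈⟨ distribʳ r 1# (- r) ⟨
      (1# - r) * r         ∎

  ZXY : GL₂
  ZXY = glZ ∙ᴳ (glX ∙ᴳ glY)

  ZXY∼CAB : matrix ZXY ∼ CAB
  ZXY∼CAB = ∼-trans (⊗-cong-∼ Z∼C (∼-trans (⊗-cong-∼ X∼A Y∼B) (≋⇒∼ A⊗B≋AB))) (≋⇒∼ C⊗AB≋CAB)

  -- Equality of the two eigenvalues forces `- r ≈ r`, so `r * 2# ≈ 0#`. Odd characteristic then
  -- gives `r ≈ 0#`, and `2# ≈ r * r` would vanish.
  ZXY^p≁I : ¬ (matrix (_^ᴳ_ PGL₂ ZXY p) ∼ I)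
  ZXY^p≁I ZXY^p∼I with √2
  ... | r , r²≈2 = 2≉0 (begin
    2#      ≈⟨ r²≈2 ⟨
    r * r   ≈⟨ *-congˡ r≈0 ⟩
    r * 0#  ≈⟨ zeroʳ r ⟩
    0#      ∎)
    where
    [-r]²≈2 : - r * - r ≈ 2#
    [-r]²≈2 = begin
      - r * - r     ≈⟨ -‿distribˡ-* r (- r) ⟨
      - (r * - r)   ≈⟨ -‿cong (-‿distribʳ-* r r) ⟨
      - (- (r * r)) ≈⟨ -‿involutive _ ⟩
      r * r         ≈⟨ r²≈2 ⟩
      2#            ∎

    -r≈r : - r ≈ r
    -r≈r = trans
      -- Cancelling `1#` in `1# - r ≈ 1# - (- r)` leaves `- r ≈ - (- r)`.
      (∙-cancelˡ 1# _ _
        (torsion⇒eigenvalues≈ K p-prime (Equivalence.from (characteristic p) ∣-refl)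
          ZXY ZXY∼CAB ZXY^p∼I (eigen-CAB r²≈2) (eigen-CAB [-r]²≈2)))
      (-‿involutive r)

    r≈0 : r ≈ 0#
    r≈0 = 2x≈0⇒x≈0 (begin
      r * 2#          ≈⟨ distribˡ r 1# 1# ⟩
      r * 1# + r * 1# ≈⟨ +-cong (*-identityʳ r) (*-identityʳ r) ⟩
      r + r           ≈⟨ +-congʳ -r≈r ⟨
      - r + r         ≈⟨ -‿inverseˡ r ⟩
      0#              ∎)

proposition3p2 : ∀ {c ℓ₁ ℓ₂} (p : ℕ) (p-prime : Prime p) (p-odd : ¬ (2 ∣ p)) →
    Hyperbolic p p {{prime⇒nonZero p-prime}} {{prime⇒nonZero p-prime}} →
    (K : HeytingField c ℓ₁ ℓ₂) (closure : IsAlgebraicClosureOfGF K p) →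
    (α : HeytingField.Carrier K) (α²≈-1 : SquareRootOfMinusOne K α) →
    ¬ SelfPetrieDual (GeneratingTriple.regularMap p-prime p-odd K closure α α²≈-1)
proposition3p2 p p-prime p-odd _ K closure α α²≈-1 dual =
  ZXY^p≁I p-prime p-odd K closure α α²≈-1
    -- The first component of `Z G.∙ (X G.∙ Y)` is `ZXY` by computation.
    (subgroup-torsion PGL₂ glX glY glZ (Z G.∙ (X G.∙ Y)) p (petrie-power regularMap dual))
  where
  open GeneratingTriple p-prime p-odd K closure α α²≈-1
  open PGL₂ K
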